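{- Let $k$ be a positive integer, let $G$ be a $k$-connected graph, and let $W\subsetneq V(G)$. Set $U=V(G)\setminus W$ and $w=|W|$. If \[ d_G(x)\ge \max\{k+1,w+1\} \] for every $x\in U$, then $G[U]$ contains an edge that is $k$-removable in $G$.
   Context: All graphs are finite, undirected and simple. A graph is $k$-connected in the usual sense: it has more than $k$ vertices and deleting any set of fewer than $k$ vertices leaves a connected graph. $G[U]$ is the subgraph of $G$ induced by $U$, and $d_G(x)$ is the degree of $x$ in $G$. An edge $e$ of a $k$-connected graph $G$ is $k$-removable if $G-e$ (delete the edge $e$, keep all vertices) is $k$-connected. -}

module Defs where

open import Data.Fin using (Fin; _≟_)
open import Data.Fin.Subset using (Subset; _∈_; ∁; ∣_∣)
open import Data.Nat using (ℕ; _<_)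
open import Data.Product using (∃; _×_; _,_; proj₁; proj₂)
open import Data.Sum using (_⊎_; inj₁; inj₂)
open import Data.Vec using (tabulate)
open import Function using (_∘_; _on_)
open import Level using (0ℓ)
open import Relation.Binary using (Rel; Symmetric; Irreflexive; Decidable)
open import Relation.Binary.Construct.Closure.ReflexiveTransitive using (Star)
open import Relation.Binary.PropositionalEquality using (_≡_; cong)
open import Relation.Nullary using (¬_; ¬?; does)
open import Relation.Nullary.Decidable using (_×-dec_; _⊎-dec_)

-- Simple graphs.  The vertex type is arbitrary so that induced subgraphs are
-- again graphs; a finite graph is, up to isomorphism, a Graph (Fin n).
record Graph (V : Set) : Set₁ where
  field
    Adj        : Rel V 0ℓ
    adj?       : Decidable Adj
    adj-sym    : Symmetric Adj
    adj-irrefl : Irreflexive _≡_ Adj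

open Graph public

-- Each edge is represented twice, once per ordering of its ends.
record Edge {V : Set} (G : Graph V) : Set where
  constructor edge
  field
    end₁ end₂ : V
    adjacent  : Adj G end₁ end₂

open Edge public

_[_] : ∀ {n} → Graph (Fin n) → (U : Subset n) → Graph (∃ (_∈ U))
G [ U ] = record
  { Adj        = Adj G on proj₁
  ; adj?       = λ x y → adj? G (proj₁ x) (proj₁ y)
  ; adj-sym    = adj-sym G
  ; adj-irrefl = adj-irrefl G ∘ cong proj₁
  }

includeEdge : ∀ {n} {G : Graph (Fin n)} {U : Subset n} → Edge (G [ U ]) → Edge G
includeEdge (edge x y xy) = edge (proj₁ x) (proj₁ y) xy

IsEnds : ∀ {V : Set} {G : Graph V} → Edge G → V → V → Set
IsEnds e x y = (x ≡ end₁ e × y ≡ end₂ e) ⊎ (x ≡ end₂ e × y ≡ end₁ e)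

deleteEdge : ∀ {n} (G : Graph (Fin n)) → Edge G → Graph (Fin n)
deleteEdge G e = record
  { Adj        = λ x y → Adj G x y × ¬ IsEnds e x y
  ; adj?       = λ x y → adj? G x y ×-dec
                   ¬? ((x ≟ end₁ e ×-dec y ≟ end₂ e) ⊎-dec
                       (x ≟ end₂ e ×-dec y ≟ end₁ e))
  ; adj-sym    = λ { (xy , ¬e) → adj-sym G xy , λ
                   { (inj₁ (p , q)) → ¬e (inj₂ (q , p))
                   ; (inj₂ (p , q)) → ¬e (inj₁ (q , p)) } }
  ; adj-irrefl = λ eq → adj-irrefl G eq ∘ proj₁
  }

degree : ∀ {n} → Graph (Fin n) → Fin n → ℕ
degree G x = ∣ tabulate (λ y → does (adj? G x y)) ∣

Connected : ∀ {V : Set} → Graph V → Set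
Connected {V} G = (x y : V) → Star (Adj G) x y

-- Connected does not ask for a vertex; this makes no difference here, since
-- fewer than k of the more than k vertices are deleted.
KConnected : ∀ {n} → ℕ → Graph (Fin n) → Set
KConnected {n} k G =
  k < n × ((S : Subset n) → ∣ S ∣ < k → Connected (G [ ∁ S ]))

Removable : ∀ {n} → ℕ → (G : Graph (Fin n)) → Edge G → Set
Removable k G e = KConnected k (deleteEdge G e)

{-# OPTIONS --safe #-}
-- Call an edge uv of G a k-cut edge when fewer than k vertices S separate u from
-- v in G - uv; these are the edges that are not k-removable.  Mader's uncrossing
-- argument: among all such separations (A, S, B) for the edges inside a vertex
-- set X, take one with |A| minimal, for an edge xy with x in A.  If x has degree
-- greater than k and lies on a second k-cut edge xz inside X, then crossing the
-- separations of xy and xz yields a smaller A.  Hence, if all edges inside X are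
-- k-cut edges and all degrees exceed k, then X has a leaf.
-- If no edge in U is removable, then U has a leaf x, with neighbour y say.  By
-- the degree bound x is joined to all of W, so the y-side B of a separation of xy
-- lies in U.  Inside B only y can have fewer than two neighbours, and it has at
-- least one.  Removing y from B leaves a set with the same property (or gives a
-- set without leaves), which cannot go on forever.
module Submission where

open import Defs
open import Data.Empty using (⊥; ⊥-elim)
open import Data.Fin using (Fin; _≟_)
open import Data.Fin.Properties using (any?; all?)
open import Data.Fin.Subset
  using (Subset; inside; outside; _∈_; _∉_; _⊆_; _⊂_; _⊃_; ⊤; ∁; _∩_; _∪_; ⁅_⁆; ∣_∣)
open import Data.Fin.Subset.Properties
open import Data.Fin.Subset.Induction using (⊂-wellFounded; ⊃-wellFounded)
open import Data.Nat
  using (ℕ; suc; _+_; _⊔_; _≤_; _<_; _≥_; z≤n; s≤s; s≤s⁻¹; _≤?_; _<?_; NonZero)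
open import Data.Nat.Induction using (<-wellFounded)
open import Data.Nat.Properties hiding (_≟_; _≤?_; _<?_)
open import Data.Nat.Tactic.RingSolver using (solve-∀)
open import Data.Product using (Σ-syntax; ∃; _×_; _,_; proj₁; proj₂)
open import Data.Sum using (_⊎_; inj₁; inj₂)
open import Data.Vec using ([]; _∷_; tabulate)
open import Data.Vec.Properties using (lookup∘tabulate; []=⇒lookup)
open import Data.Vec.Properties.WithK using ([]=-irrelevant)
open import Function using (_∘_)
open import Induction.WellFounded using (Acc; acc)
open import Relation.Binary.Construct.Closure.ReflexiveTransitive using (Star; ε; _◅_; _◅◅_)
open import Relation.Binary.PropositionalEquality
  using (_≡_; _≢_; refl; sym; trans; cong; subst)
open import Relation.Nullary using (¬_; Dec; yes; no; does; contradiction)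
open import Relation.Nullary.Decidable
  using (_×-dec_; _→-dec_; ¬?; map′; decidable-stable)

-- Sizes of finite subsets.

∣p∪q∣≤∣p∣+∣q∣ : ∀ {n} (p q : Subset n) → ∣ p ∪ q ∣ ≤ ∣ p ∣ + ∣ q ∣
∣p∪q∣≤∣p∣+∣q∣ []            []            = z≤n
∣p∪q∣≤∣p∣+∣q∣ (outside ∷ p) (outside ∷ q) = ∣p∪q∣≤∣p∣+∣q∣ p q
∣p∪q∣≤∣p∣+∣q∣ (outside ∷ p) (inside  ∷ q) =
  ≤-trans (s≤s (∣p∪q∣≤∣p∣+∣q∣ p q)) (≤-reflexive (sym (+-suc ∣ p ∣ ∣ q ∣)))
∣p∪q∣≤∣p∣+∣q∣ (inside  ∷ p) (outside ∷ q) = s≤s (∣p∪q∣≤∣p∣+∣q∣ p q)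
∣p∪q∣≤∣p∣+∣q∣ (inside  ∷ p) (inside  ∷ q) =
  s≤s (≤-trans (∣p∪q∣≤∣p∣+∣q∣ p q) (+-monoʳ-≤ ∣ p ∣ (n≤1+n ∣ q ∣)))

∣p∪⁅x⁆∣≤1+∣p∣ : ∀ {n} (p : Subset n) x → ∣ p ∪ ⁅ x ⁆ ∣ ≤ suc ∣ p ∣
∣p∪⁅x⁆∣≤1+∣p∣ p x = begin
  ∣ p ∪ ⁅ x ⁆ ∣      ≤⟨ ∣p∪q∣≤∣p∣+∣q∣ p ⁅ x ⁆ ⟩
  ∣ p ∣ + ∣ ⁅ x ⁆ ∣  ≡⟨ cong (∣ p ∣ +_) (∣⁅x⁆∣≡1 x) ⟩
  ∣ p ∣ + 1          ≡⟨ +-comm ∣ p ∣ 1 ⟩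
  suc ∣ p ∣          ∎
  where open ≤-Reasoning

∣p∩q∣+∣p∩∁q∣≡∣p∣ : ∀ {n} (p q : Subset n) → ∣ p ∩ q ∣ + ∣ p ∩ ∁ q ∣ ≡ ∣ p ∣
∣p∩q∣+∣p∩∁q∣≡∣p∣ []            []            = refl
∣p∩q∣+∣p∩∁q∣≡∣p∣ (outside ∷ p) (_       ∷ q) = ∣p∩q∣+∣p∩∁q∣≡∣p∣ p q
∣p∩q∣+∣p∩∁q∣≡∣p∣ (inside  ∷ p) (inside  ∷ q) = cong suc (∣p∩q∣+∣p∩∁q∣≡∣p∣ p q)
∣p∩q∣+∣p∩∁q∣≡∣p∣ (inside  ∷ p) (outside ∷ q) =
  trans (+-suc _ _) (cong suc (∣p∩q∣+∣p∩∁q∣≡∣p∣ p q))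

disjoint-∣+∣≤ : ∀ {n} {p q r : Subset n} → p ⊆ r → q ⊆ r →
                (∀ {x} → x ∈ p → x ∉ q) → ∣ p ∣ + ∣ q ∣ ≤ ∣ r ∣
disjoint-∣+∣≤ {p = p} {q} {r} p⊆r q⊆r p∌q = begin
  ∣ p ∣ + ∣ q ∣          ≤⟨ +-mono-≤
                              (p⊆q⇒∣p∣≤∣q∣ (λ x∈p → x∈p∩q⁺ (p⊆r x∈p , x∈p)))
                              (p⊆q⇒∣p∣≤∣q∣ (λ x∈q → x∈p∩q⁺
                                (q⊆r x∈q , x∉p⇒x∈∁p (λ x∈p → p∌q x∈p x∈q)))) ⟩
  ∣ r ∩ p ∣ + ∣ r ∩ ∁ p ∣  ≡⟨ ∣p∩q∣+∣p∩∁q∣≡∣p∣ r p ⟩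
  ∣ r ∣                  ∎
  where open ≤-Reasoning

∉-∪⁻ : ∀ {n} {p q : Subset n} {x} → x ∉ p ∪ q → x ∉ p × x ∉ q
∉-∪⁻ x∉ = (λ x∈p → x∉ (x∈p∪q⁺ (inj₁ x∈p))) , (λ x∈q → x∉ (x∈p∪q⁺ (inj₂ x∈q)))

infixl 5 _∖_

_∖_ : ∀ {n} → Subset n → Fin n → Subset n
p ∖ x = p ∩ ∁ ⁅ x ⁆

∈-∖⁺ : ∀ {n} {p : Subset n} {x y} → y ∈ p → y ≢ x → y ∈ p ∖ x
∈-∖⁺ y∈p y≢x = x∈p∩q⁺ (y∈p , x∉p⇒x∈∁p (x≢y⇒x∉⁅y⁆ y≢x))

∈-∖⁻ : ∀ {n} {p : Subset n} {x y} → y ∈ p ∖ x → y ∈ p × y ≢ x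
∈-∖⁻ {p = p} y∈ = let y∈p , y∈∁x = x∈p∩q⁻ p _ y∈ in y∈p , x∉⁅y⁆⇒x≢y (x∈∁p⇒x∉p y∈∁x)

∖-⊂ : ∀ {n} {p : Subset n} {x} → x ∈ p → p ∖ x ⊂ p
∖-⊂ {p = p} {x} x∈p = p∩q⊆p p _ , x , x∈p , λ x∈ → proj₂ (∈-∖⁻ {p = p} x∈) refl

∉-∪⁺ : ∀ {n} {p q : Subset n} {x} → x ∉ p → x ∉ q → x ∉ p ∪ q
∉-∪⁺ {p = p} {q} x∉p x∉q x∈ with x∈p∪q⁻ p q x∈
... | inj₁ x∈p = x∉p x∈p
... | inj₂ x∈q = x∉q x∈q

-- Closing a set of vertices under a relation.

module _ {n : ℕ} (P : Fin n → Set) (E : Fin n → Fin n → Set)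
         (E? : ∀ x y → Dec (E x y)) (P-step : ∀ {x y} → P x → E x y → P y) where

  -- `R` grows by one vertex for each `E`-step that leaves it, which stops because there are only
  -- `n` vertices. `P` itself may be undecidable, as reachability by paths is at first, whereas
  -- membership in the resulting `Subset` is decidable.
  closure-⊇ : ∀ R → Acc _⊃_ R → (∀ {x} → x ∈ R → P x) →
              Σ[ R′ ∈ Subset n ] R ⊆ R′ × (∀ {x} → x ∈ R′ → P x) ×
                (∀ {x y} → x ∈ R′ → E x y → y ∈ R′)
  closure-⊇ R (acc rs) R⊆P
    with any? (λ x → any? (λ y → x ∈? R ×-dec ¬? (y ∈? R) ×-dec E? x y))
  ... | no ¬step = R , (λ x∈R → x∈R) , R⊆P , closed
    where
    closed : ∀ {x y} → x ∈ R → E x y → y ∈ R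
    closed {x} {y} x∈R xy =
      decidable-stable (y ∈? R) (λ y∉R → ¬step (x , y , x∈R , y∉R , xy))
  ... | yes (x , y , x∈R , y∉R , xy)
    with closure-⊇ (R ∪ ⁅ y ⁆)
           (rs (p⊆p∪q _ , y , q⊆p∪q R _ (x∈⁅x⁆ y) , y∉R)) R∪y⊆P
    where
    R∪y⊆P : ∀ {z} → z ∈ R ∪ ⁅ y ⁆ → P z
    R∪y⊆P {z} z∈ with x∈p∪q⁻ R ⁅ y ⁆ z∈
    ... | inj₁ z∈R = R⊆P z∈R
    ... | inj₂ z∈y = subst P (sym (x∈⁅y⁆⇒x≡y y z∈y)) (P-step (R⊆P x∈R) xy)
  ... | R′ , R⊆R′ , rest = R′ , R⊆R′ ∘ p⊆p∪q _ , rest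

  closure : ∀ {x} → P x → Σ[ R ∈ Subset n ] x ∈ R × (∀ {y} → y ∈ R → P y) ×
              (∀ {y z} → y ∈ R → E y z → z ∈ R)
  closure {x} Px with closure-⊇ ⁅ x ⁆ (⊃-wellFounded _)
                        (λ y∈ → subst P (sym (x∈⁅y⁆⇒x≡y x y∈)) Px)
  ... | R , x⊆R , rest = R , x⊆R (x∈⁅x⁆ x) , rest

-- The left side is at least `2k`, the right side at most `2k - 1`. Below, `i` and `j` bound the
-- separators of two cuts, and `i′`, `j′` bound two opposite corners, one of them enlarged by a
-- vertex.
squeeze : ∀ {k i j i′ j′} → i < k → j < k → k ≤ i′ → k ≤ j′ → i′ + j′ ≡ suc (i + j) → ⊥
squeeze {k} {i} {j} {i′} {j′} i<k j<k k≤i′ k≤j′ eq = <-irrefl refl (begin-strict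
  suc (i + j)    <⟨ ≤-reflexive (sym (cong suc (+-suc i j))) ⟩
  suc i + suc j  ≤⟨ +-mono-≤ i<k j<k ⟩
  k + k          ≤⟨ +-mono-≤ k≤i′ k≤j′ ⟩
  i′ + j′        ≡⟨ eq ⟩
  suc (i + j)    ∎)
  where open ≤-Reasoning

-- Neighbourhoods and cuts.

module _ {n : ℕ} (G : Graph (Fin n)) where

  neighbours : Fin n → Subset n
  neighbours x = tabulate (λ y → does (adj? G x y))

  ∈-neighbours⁻ : ∀ {x y} → y ∈ neighbours x → Adj G x y
  ∈-neighbours⁻ {x} {y} y∈ with adj? G x y in eq
  ... | yes xy = xy
  ... | no  _  with trans (sym ([]=⇒lookup y∈))
                     (trans (lookup∘tabulate (λ y → does (adj? G x y)) y) (cong does eq))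
  ...   | ()

  neighbour-outside : ∀ {x} T → ∣ T ∣ < degree G x → ∃ λ y → Adj G x y × y ∉ T
  neighbour-outside {x} T T<d with any? (λ y → adj? G x y ×-dec ¬? (y ∈? T))
  ... | yes found = found
  ... | no  none  = contradiction T<d (≤⇒≯ (p⊆q⇒∣p∣≤∣q∣ N⊆T))
    where
    N⊆T : neighbours x ⊆ T
    N⊆T {y} y∈ = decidable-stable (y ∈? T) (λ y∉T → none (y , ∈-neighbours⁻ y∈ , y∉T))

  -- The sides are explicit vertex sets, unions of components of `G - uv - S`, instead of a
  -- statement about paths. This allows two cuts to be intersected and their sides to be compared in
  -- size.
  record Cut (k : ℕ) (u v : Fin n) : Set where
    field
      A S B   : Subset n
      cover   : ∀ p → p ∈ A ⊎ p ∈ S ⊎ p ∈ B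
      A∌S     : ∀ {p} → p ∈ A → p ∉ S
      A∌B     : ∀ {p} → p ∈ A → p ∉ B
      S∌B     : ∀ {p} → p ∈ S → p ∉ B
      small   : ∣ S ∣ < k
      end∈A   : u ∈ A
      end∈B   : v ∈ B
      crosses : ∀ {p q} → p ∈ A → q ∈ B → Adj G p q → p ≡ u × q ≡ v

  open Cut

  swap : ∀ {k u v} → Cut k u v → Cut k v u
  swap F = record
    { A = B F ; S = S F ; B = A F
    ; cover = λ p → swap-cover (cover F p)
    ; A∌S = λ p∈B p∈S → S∌B F p∈S p∈B
    ; A∌B = λ p∈B p∈A → A∌B F p∈A p∈B
    ; S∌B = λ p∈S p∈A → A∌S F p∈A p∈S
    ; small = small F ; end∈A = end∈B F ; end∈B = end∈A F
    ; crosses = λ p∈B q∈A pq → let q≡u , p≡v = crosses F q∈A p∈B (adj-sym G pq) in p≡v , q≡u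
    }
    where
    swap-cover : ∀ {X Y Z : Set} → X ⊎ Y ⊎ Z → Z ⊎ Y ⊎ X
    swap-cover (inj₁ x)        = inj₂ (inj₂ x)
    swap-cover (inj₂ (inj₁ y)) = inj₂ (inj₁ y)
    swap-cover (inj₂ (inj₂ z)) = inj₁ z

  -- The same condition on `A` and `S` alone, with `B` as the remaining vertices. Each clause is
  -- decidable, so cuts can be found by searching all pairs of subsets.
  IsCut : ℕ → Fin n → Fin n → Subset n → Subset n → Set
  IsCut k u v A S =
    ∣ S ∣ < k × u ∈ A × v ∉ A × v ∉ S × (∀ p → p ∈ A → p ∉ S) ×
    (∀ p q → p ∈ A → q ∉ A → q ∉ S → Adj G p q → p ≡ u × q ≡ v)

  isCut? : ∀ k u v A S → Dec (IsCut k u v A S)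
  isCut? k u v A S =
    ∣ S ∣ <? k ×-dec u ∈? A ×-dec ¬? (v ∈? A) ×-dec ¬? (v ∈? S) ×-dec
    all? (λ p → p ∈? A →-dec ¬? (p ∈? S)) ×-dec
    all? (λ p → all? (λ q → p ∈? A →-dec ¬? (q ∈? A) →-dec ¬? (q ∈? S) →-dec
      adj? G p q →-dec (p ≟ u ×-dec q ≟ v)))

  isCut⇒cut : ∀ {k u v A S} → IsCut k u v A S → Cut k u v
  isCut⇒cut {A = A} {S} (S<k , u∈A , v∉A , v∉S , A∌S , A→B) = record
    { A = A ; S = S ; B = ∁ (A ∪ S)
    ; cover = cov
    ; A∌S = A∌S _
    ; A∌B = λ p∈A p∈B → x∈∁p⇒x∉p p∈B (x∈p∪q⁺ (inj₁ p∈A))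
    ; S∌B = λ p∈S p∈B → x∈∁p⇒x∉p p∈B (x∈p∪q⁺ (inj₂ p∈S))
    ; small = S<k ; end∈A = u∈A
    ; end∈B = x∉p⇒x∈∁p (∉-∪⁺ v∉A v∉S)
    ; crosses = λ p∈A q∈B pq → let q∉A , q∉S = ∉-∪⁻ (x∈∁p⇒x∉p q∈B) in
                  A→B _ _ p∈A q∉A q∉S pq
    }
    where
    cov : ∀ p → p ∈ A ⊎ p ∈ S ⊎ p ∈ ∁ (A ∪ S)
    cov p with p ∈? A | p ∈? S
    ... | yes p∈A | _       = inj₁ p∈A
    ... | no  _   | yes p∈S = inj₂ (inj₁ p∈S)
    ... | no  p∉A | no p∉S  = inj₂ (inj₂ (x∉p⇒x∈∁p (∉-∪⁺ p∉A p∉S)))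

  cut⇒isCut : ∀ {k u v} (F : Cut k u v) → IsCut k u v (A F) (S F)
  cut⇒isCut F =
    small F , end∈A F , (λ v∈A → A∌B F v∈A (end∈B F)) , (λ v∈S → S∌B F v∈S (end∈B F)) ,
    (λ _ → A∌S F) , λ p q p∈A q∉A q∉S → crosses F p∈A (∈B q∉A q∉S (cover F q))
    where
    ∈B : ∀ {q} → q ∉ A F → q ∉ S F → q ∈ A F ⊎ q ∈ S F ⊎ q ∈ B F → q ∈ B F
    ∈B q∉A _   (inj₁ q∈A)        = contradiction q∈A q∉A
    ∈B _   q∉S (inj₂ (inj₁ q∈S)) = contradiction q∈S q∉S
    ∈B _   _   (inj₂ (inj₂ q∈B)) = q∈B

  cut? : ∀ k u v → Dec (Cut k u v)
  cut? k u v = map′ (λ { (_ , _ , c) → isCut⇒cut c }) (λ F → A F , S F , cut⇒isCut F)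
    (anySubset? (λ A → anySubset? (λ S → isCut? k u v A S)))

  -- Corners of two crossing cuts.

  corner : ∀ {k u v u′ v′} → Cut k u v → Cut k u′ v′ → Subset n
  corner F F′ = (S F ∩ A F′) ∪ (S F ∩ S F′) ∪ (A F ∩ S F′)

  ∣corner∣≤ : ∀ {k u v u′ v′} (F : Cut k u v) (F′ : Cut k u′ v′) →
              ∣ corner F F′ ∣ ≤ ∣ S F ∩ A F′ ∣ + (∣ S F ∩ S F′ ∣ + ∣ A F ∩ S F′ ∣)
  ∣corner∣≤ F F′ = ≤-trans (∣p∪q∣≤∣p∣+∣q∣ (S F ∩ A F′) _)
    (+-monoʳ-≤ ∣ S F ∩ A F′ ∣ (∣p∪q∣≤∣p∣+∣q∣ (S F ∩ S F′) _))

  -- A neighbour in `B F` or `B F′` is reached only along a cut edge; any other neighbour outside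
  -- `A F ∩ A F′` lies in one separator and not beyond the other. With `swap` this covers all four
  -- corners.
  corner-closed : ∀ {k u v u′ v′} (F : Cut k u v) (F′ : Cut k u′ v′) {p q} →
    p ∈ A F ∩ A F′ → Adj G p q →
    q ∈ A F ∩ A F′ ⊎ q ∈ corner F F′ ⊎ (p ≡ u × q ≡ v) ⊎ (p ≡ u′ × q ≡ v′)
  corner-closed F F′ {p} {q} p∈ pq with x∈p∩q⁻ (A F) (A F′) p∈ | cover F q | cover F′ q
  ... | p∈A , _    | inj₂ (inj₂ q∈B) | _                = inj₂ (inj₂ (inj₁ (crosses F p∈A q∈B pq)))
  ... | _   , p∈A′ | _               | inj₂ (inj₂ q∈B′) = inj₂ (inj₂ (inj₂ (crosses F′ p∈A′ q∈B′ pq)))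
  ... | _ | inj₁ q∈A        | inj₁ q∈A′        = inj₁ (x∈p∩q⁺ (q∈A , q∈A′))
  ... | _ | inj₂ (inj₁ q∈S) | inj₁ q∈A′        =
    inj₂ (inj₁ (x∈p∪q⁺ (inj₁ (x∈p∩q⁺ (q∈S , q∈A′)))))
  ... | _ | inj₂ (inj₁ q∈S) | inj₂ (inj₁ q∈S′) =
    inj₂ (inj₁ (x∈p∪q⁺ (inj₂ (x∈p∪q⁺ (inj₁ (x∈p∩q⁺ (q∈S , q∈S′)))))))
  ... | _ | inj₁ q∈A        | inj₂ (inj₁ q∈S′) =
    inj₂ (inj₁ (x∈p∪q⁺ (inj₂ (x∈p∪q⁺ (inj₂ (x∈p∩q⁺ (q∈A , q∈S′)))))))

  corner∌ : ∀ {k u v u′ v′} (F : Cut k u v) (F′ : Cut k u′ v′) {p} →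
            p ∈ A F → p ∈ A F′ → p ∉ corner F F′
  corner∌ F F′ p∈A p∈A′ p∈ with x∈p∪q⁻ (S F ∩ A F′) _ p∈
  ... | inj₁ p∈₁ = A∌S F p∈A (proj₁ (x∈p∩q⁻ _ _ p∈₁))
  ... | inj₂ p∈₂ with x∈p∪q⁻ (S F ∩ S F′) _ p∈₂
  ...   | inj₁ p∈₁ = A∌S F p∈A (proj₁ (x∈p∩q⁻ _ _ p∈₁))
  ...   | inj₂ p∈₃ = A∌S F′ p∈A′ (proj₂ (x∈p∩q⁻ _ _ p∈₃))

  corner∌B : ∀ {k u v u′ v′} (F : Cut k u v) (F′ : Cut k u′ v′) {p} →
             p ∈ B F → p ∉ corner F F′
  corner∌B F F′ p∈B p∈ with x∈p∪q⁻ (S F ∩ A F′) _ p∈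
  ... | inj₁ p∈₁ = S∌B F (proj₁ (x∈p∩q⁻ _ _ p∈₁)) p∈B
  ... | inj₂ p∈₂ with x∈p∪q⁻ (S F ∩ S F′) _ p∈₂
  ...   | inj₁ p∈₁ = S∌B F (proj₁ (x∈p∩q⁻ _ _ p∈₁)) p∈B
  ...   | inj₂ p∈₃ = A∌B F (proj₁ (x∈p∩q⁻ _ _ p∈₃)) p∈B

  corner∌B′ : ∀ {k u v u′ v′} (F : Cut k u v) (F′ : Cut k u′ v′) {p} →
              p ∈ B F′ → p ∉ corner F F′
  corner∌B′ F F′ p∈B p∈ with x∈p∪q⁻ (S F ∩ A F′) _ p∈
  ... | inj₁ p∈₁ = A∌B F′ (proj₂ (x∈p∩q⁻ _ _ p∈₁)) p∈B
  ... | inj₂ p∈₂ with x∈p∪q⁻ (S F ∩ S F′) _ p∈₂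
  ...   | inj₁ p∈₁ = S∌B F′ (proj₂ (x∈p∩q⁻ _ _ p∈₁)) p∈B
  ...   | inj₂ p∈₃ = S∌B F′ (proj₂ (x∈p∩q⁻ _ _ p∈₃)) p∈B

  ∣∩sides∣≤ : ∀ {k u v} (F : Cut k u v) (T : Subset n) →
              ∣ A F ∩ T ∣ + (∣ S F ∩ T ∣ + ∣ B F ∩ T ∣) ≤ ∣ T ∣
  ∣∩sides∣≤ F T = begin
    ∣ A F ∩ T ∣ + (∣ S F ∩ T ∣ + ∣ B F ∩ T ∣)
      ≤⟨ +-monoʳ-≤ ∣ A F ∩ T ∣ (disjoint-∣+∣≤ {r = T ∩ ∁ (A F)}
           (λ x∈ → let x∈S , x∈T = x∈p∩q⁻ _ _ x∈ in
              x∈p∩q⁺ (x∈T , x∉p⇒x∈∁p (λ x∈A → A∌S F x∈A x∈S)))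
           (λ x∈ → let x∈B , x∈T = x∈p∩q⁻ _ _ x∈ in
              x∈p∩q⁺ (x∈T , x∉p⇒x∈∁p (λ x∈A → A∌B F x∈A x∈B)))
           (λ x∈ x∈′ → S∌B F (proj₁ (x∈p∩q⁻ _ _ x∈)) (proj₁ (x∈p∩q⁻ _ _ x∈′)))) ⟩
    ∣ A F ∩ T ∣ + ∣ T ∩ ∁ (A F) ∣
      ≡⟨ cong (λ X → ∣ X ∣ + ∣ T ∩ ∁ (A F) ∣) (∩-comm (A F) T) ⟩
    ∣ T ∩ A F ∣ + ∣ T ∩ ∁ (A F) ∣
      ≡⟨ ∣p∩q∣+∣p∩∁q∣≡∣p∣ T (A F) ⟩
    ∣ T ∣ ∎
    where open ≤-Reasoning

  -- Uncrossing in a `k`-connected graph.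

  module _ {k : ℕ} (κ : KConnected k G) where

    -- A path from `c` that avoids `T` never leaves `C`, so `T` separates `c` from `d`.
    separator : ∀ {C T c d} → c ∈ C → c ∉ T → d ∉ C → d ∉ T →
                (∀ {p q} → p ∈ C → Adj G p q → q ∈ C ⊎ q ∈ T) → k ≤ ∣ T ∣
    separator {C} {T} {c} {d} c∈C c∉T d∉C d∉T C-closed = ≮⇒≥ λ T<k →
      d∉C (stay (proj₂ κ T T<k (c , x∉p⇒x∈∁p c∉T) (d , x∉p⇒x∈∁p d∉T)) c∈C)
      where
      stay : ∀ {a b} → Star (Adj (G [ ∁ T ])) a b → proj₁ a ∈ C → proj₁ b ∈ C
      stay ε                           a∈C = a∈C
      stay (_◅_ {j = q , q∈∁T} aq qb) a∈C with C-closed a∈C aq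
      ... | inj₁ q∈C = stay qb q∈C
      ... | inj₂ q∈T = contradiction q∈T (x∈∁p⇒x∉p q∈∁T)

    -- The new side is `A F ∩ B F′`, separated by its corner; it is smaller because it misses `x`.
    -- The two size comparisons, which hold when `A F` is smallest possible, exclude that this
    -- corner has `k` or more vertices and that the new side misses `z`.
    uncross : ∀ {x y z} → k < degree G x → Adj G x y → Adj G x z → z ≢ y →
              (F : Cut k x y) (F′ : Cut k x z) →
              ∣ A F ∣ ≤ ∣ B F ∣ → ∣ A F ∣ ≤ ∣ B F′ ∣ →
              Σ[ F″ ∈ Cut k z x ] ∣ A F″ ∣ < ∣ A F ∣
    uncross {x} {y} {z} k<d xy xz z≢y F F′ A≤B A≤B′ = conclude (k ≤? ∣ corner F (swap F′) ∣)
      where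
      -- The sides of `F′` split `S F` into `p`, `r`, `q`, and the sides of `F` split `S F′` into
      -- `a`, `r`, `b`.
      p = ∣ S F ∩ A F′ ∣
      q = ∣ S F ∩ B F′ ∣
      r = ∣ S F ∩ S F′ ∣
      a = ∣ A F ∩ S F′ ∣
      b = ∣ B F ∩ S F′ ∣

      x≢y : x ≢ y
      x≢y x≡y = adj-irrefl G x≡y xy

      x∈A  = end∈A F
      x∈A′ = end∈A F′

      y∉B′ : y ∉ B F′
      y∉B′ y∈B′ = z≢y (sym (proj₂ (crosses F′ x∈A′ y∈B′ xy)))

      z∉B : z ∉ B F
      z∉B z∈B = z≢y (proj₂ (crosses F x∈A z∈B xz))

      S<k : p + (r + q) < k
      S<k = ≤-<-trans (≤-trans (≤-reflexive reorder) (∣∩sides∣≤ F′ (S F))) (small F)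
        where
        reorder : p + (r + q) ≡ ∣ A F′ ∩ S F ∣ + (∣ S F′ ∩ S F ∣ + ∣ B F′ ∩ S F ∣)
        reorder rewrite ∩-comm (S F) (A F′) | ∩-comm (S F) (S F′) | ∩-comm (S F) (B F′) = refl

      S′<k : a + (r + b) < k
      S′<k = ≤-<-trans (∣∩sides∣≤ F (S F′)) (small F′)

      a<A : a < ∣ A F ∣
      a<A = p⊂q⇒∣p∣<∣q∣
        (p∩q⊆p (A F) (S F′) , x , x∈A , λ x∈ → A∌S F′ x∈A′ (proj₂ (x∈p∩q⁻ (A F) _ x∈)))

      -- Here the degree of x is used: otherwise A ∩ A′ could be just {x}.
      AA′ : k ≤ suc (p + (r + a))
      AA′ = ≤-trans (≮⇒≥ refute) (s≤s (∣corner∣≤ F F′))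
        where
        T = corner F F′
        refute : ¬ (suc ∣ T ∣ < k)
        refute T<k with neighbour-outside {x} ((T ∪ ⁅ y ⁆) ∪ ⁅ z ⁆)
                          (≤-<-trans (∣p∪⁅x⁆∣≤1+∣p∣ (T ∪ ⁅ y ⁆) z)
                            (≤-<-trans (s≤s (∣p∪⁅x⁆∣≤1+∣p∣ T y)) (≤-<-trans T<k k<d)))
        ... | t , xt , t∉ with ∉-∪⁻ t∉
        ...   | t∉Ty , t∉z with ∉-∪⁻ t∉Ty | corner-closed F F′ (x∈p∩q⁺ (x∈A , x∈A′)) xt
        ...     | t∉T , t∉y | inj₂ (inj₁ t∈T) = t∉T t∈T
        ...     | t∉T , t∉y | inj₂ (inj₂ (inj₁ (_ , t≡y))) = x∉⁅y⁆⇒x≢y t∉y t≡y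
        ...     | t∉T , t∉y | inj₂ (inj₂ (inj₂ (_ , t≡z))) = x∉⁅y⁆⇒x≢y t∉z t≡z
        -- Both cut edges leave `A F ∩ A F′` at `x`. With `x` moved into the separator, `T` and `x`
        -- together, fewer than `k` vertices, cut `t` off from `y`.
        ...     | t∉T , t∉y | inj₁ t∈ = <⇒≱ T<k (≤-trans
          (separator {C = A F ∩ A F′ ∖ x} {T = T ∪ ⁅ x ⁆} {d = y} (∈-∖⁺ t∈ t≢x)
            (∉-∪⁺ t∉T (x≢y⇒x∉⁅y⁆ t≢x))
            (λ y∈ → A∌B F (proj₁ (x∈p∩q⁻ _ _ (proj₁ (∈-∖⁻ {p = A F ∩ A F′} y∈)))) (end∈B F))
            (∉-∪⁺ (corner∌B F F′ (end∈B F)) (x≢y⇒x∉⁅y⁆ (x≢y ∘ sym))) closed)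
          (∣p∪⁅x⁆∣≤1+∣p∣ T x))
          where
          t≢x : t ≢ x
          t≢x t≡x = adj-irrefl G (sym t≡x) xt
          closed : ∀ {s t} → s ∈ A F ∩ A F′ ∖ x → Adj G s t →
                   t ∈ A F ∩ A F′ ∖ x ⊎ t ∈ T ∪ ⁅ x ⁆
          closed {s} {t} s∈ st with ∈-∖⁻ {p = A F ∩ A F′} s∈ | t ≟ x
          ... | _         | yes refl = inj₂ (q⊆p∪q T _ (x∈⁅x⁆ x))
          ... | s∈₁ , s≢x | no  t≢x with corner-closed F F′ s∈₁ st
          ...   | inj₁ t∈                        = inj₁ (∈-∖⁺ t∈ t≢x)
          ...   | inj₂ (inj₁ t∈T)                = inj₂ (p⊆p∪q _ t∈T)
          ...   | inj₂ (inj₂ (inj₁ (s≡x , _)))   = contradiction s≡x s≢x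
          ...   | inj₂ (inj₂ (inj₂ (s≡x , _)))   = contradiction s≡x s≢x

      -- Neither cut edge leaves `B F ∩ B F′`, since `y` is not in `B F′` and `z` is not in `B F`.
      -- If this set were nonempty, its corner would have at least `k` vertices, too many beside
      -- `AA′`.
      BB′-empty : ∀ {t} → t ∈ B F → t ∉ B F′
      BB′-empty {t} t∈B t∈B′ = squeeze S<k S′<k k≤BB′ AA′ (identity p q r a b)
        where
        identity : ∀ p q r a b → (q + (r + b)) + suc (p + (r + a)) ≡ suc ((p + (r + q)) + (a + (r + b)))
        identity = solve-∀
        closed : ∀ {s t} → s ∈ B F ∩ B F′ → Adj G s t →
                 t ∈ B F ∩ B F′ ⊎ t ∈ corner (swap F) (swap F′)
        closed s∈ st with corner-closed (swap F) (swap F′) s∈ st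
        ... | inj₁ t∈ = inj₁ t∈
        ... | inj₂ (inj₁ t∈T) = inj₂ t∈T
        ... | inj₂ (inj₂ (inj₁ (refl , _))) = contradiction (proj₂ (x∈p∩q⁻ (B F) _ s∈)) y∉B′
        ... | inj₂ (inj₂ (inj₂ (refl , _))) = contradiction (proj₁ (x∈p∩q⁻ (B F) _ s∈)) z∉B
        k≤BB′ : k ≤ q + (r + b)
        k≤BB′ = ≤-trans
          (separator (x∈p∩q⁺ (t∈B , t∈B′)) (corner∌ (swap F) (swap F′) t∈B t∈B′)
            (λ x∈ → A∌B F x∈A (proj₁ (x∈p∩q⁻ _ _ x∈))) (corner∌B (swap F) (swap F′) x∈A) closed)
          (∣corner∣≤ (swap F) (swap F′))

      -- The edge `xy` may leave `B F ∩ A F′`, so `x` joins the separator; this accounts for the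
      -- `suc`. The edge `xz` cannot leave it, as `x` is not in `B F`.
      BA′ : ∀ {t} → t ∈ B F → t ∈ A F′ → k ≤ suc (p + (r + b))
      BA′ {t} t∈B t∈A′ = ≤-trans
        (separator {C = B F ∩ A F′} {T = T ∪ ⁅ x ⁆} {d = z} (x∈p∩q⁺ (t∈B , t∈A′))
          (∉-∪⁺ (corner∌ (swap F) F′ t∈B t∈A′) (x≢y⇒x∉⁅y⁆ (λ { refl → A∌B F x∈A t∈B })))
          (λ z∈ → z∉B (proj₁ (x∈p∩q⁻ _ _ z∈)))
          (∉-∪⁺ (corner∌B′ (swap F) F′ (end∈B F′))
            (x≢y⇒x∉⁅y⁆ (λ z≡x → adj-irrefl G (sym z≡x) xz))) closed)
        (≤-trans (∣p∪⁅x⁆∣≤1+∣p∣ T x) (s≤s (∣corner∣≤ (swap F) F′)))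
        where
        T = corner (swap F) F′
        closed : ∀ {s t} → s ∈ B F ∩ A F′ → Adj G s t → t ∈ B F ∩ A F′ ⊎ t ∈ T ∪ ⁅ x ⁆
        closed s∈ st with corner-closed (swap F) F′ s∈ st
        ... | inj₁ t∈ = inj₁ t∈
        ... | inj₂ (inj₁ t∈T) = inj₂ (p⊆p∪q _ t∈T)
        ... | inj₂ (inj₂ (inj₁ (_ , refl))) = inj₂ (q⊆p∪q T _ (x∈⁅x⁆ x))
        ... | inj₂ (inj₂ (inj₂ (refl , _))) = contradiction (proj₁ (x∈p∩q⁻ (B F) _ s∈)) (A∌B F x∈A)

      x∉AB′ : x ∉ A F ∩ B F′
      x∉AB′ x∈ = A∌B F′ x∈A′ (proj₂ (x∈p∩q⁻ (A F) _ x∈))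

      AB′-exit : ∀ {s t} → s ∈ A F ∩ B F′ → t ∉ A F ∩ B F′ → t ∉ corner F (swap F′) →
                 Adj G s t → s ≡ z × t ≡ x
      AB′-exit s∈ t∉ t∉T st with corner-closed F (swap F′) s∈ st
      ... | inj₁ t∈                       = contradiction t∈ t∉
      ... | inj₂ (inj₁ t∈T)               = contradiction t∈T t∉T
      ... | inj₂ (inj₂ (inj₁ (refl , _))) = contradiction s∈ x∉AB′
      ... | inj₂ (inj₂ (inj₂ s≡z,t≡x))    = s≡z,t≡x

      B≤b : (∀ {t} → t ∈ B F → t ∉ A F′) → ∣ B F ∣ ≤ b
      B≤b B∌A′ = p⊆q⇒∣p∣≤∣q∣ B⊆S′
        where
        B⊆S′ : B F ⊆ B F ∩ S F′
        B⊆S′ {t} t∈B with cover F′ t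
        ... | inj₁ t∈A′        = contradiction t∈A′ (B∌A′ t∈B)
        ... | inj₂ (inj₁ t∈S′) = x∈p∩q⁺ (t∈B , t∈S′)
        ... | inj₂ (inj₂ t∈B′) = contradiction t∈B′ (BB′-empty t∈B)

      B′≤q : (∀ {t} → t ∉ A F ∩ B F′) → ∣ B F′ ∣ ≤ q
      B′≤q AB′-empty = p⊆q⇒∣p∣≤∣q∣ B′⊆S
        where
        B′⊆S : B F′ ⊆ S F ∩ B F′
        B′⊆S {t} t∈B′ with cover F t
        ... | inj₁ t∈A        = contradiction (x∈p∩q⁺ (t∈A , t∈B′)) AB′-empty
        ... | inj₂ (inj₁ t∈S) = x∈p∩q⁺ (t∈S , t∈B′)
        ... | inj₂ (inj₂ t∈B) = contradiction t∈B′ (BB′-empty t∈B)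

      -- Counting against the opposite corner empties `B F ∩ A F′`, so `B F` lies in `S F′` and has
      -- at most `b` vertices. Comparing each separator with a corner gives `b ≤ p < a`, whereas
      -- `a < ∣ A F ∣ ≤ ∣ B F ∣`.
      large-impossible : k ≤ ∣ corner F (swap F′) ∣ → ⊥
      large-impossible k≤T = <-irrefl refl (begin-strict
        b        ≤⟨ +-cancelʳ-≤ (r + a) b p (b+≤p+) ⟩
        p        <⟨ +-cancelʳ-< (r + q) p a p+<a+ ⟩
        a        <⟨ a<A ⟩
        ∣ A F ∣  ≤⟨ A≤B ⟩
        ∣ B F ∣  ≤⟨ B≤b B∌A′ ⟩
        b        ∎)
        where
        open ≤-Reasoning
        k≤AB′ : k ≤ q + (r + a)
        k≤AB′ = ≤-trans k≤T (∣corner∣≤ F (swap F′))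
        identity : ∀ p q r a b → (q + (r + a)) + suc (p + (r + b)) ≡ suc ((p + (r + q)) + (a + (r + b)))
        identity = solve-∀
        B∌A′ : ∀ {t} → t ∈ B F → t ∉ A F′
        B∌A′ t∈B t∈A′ = squeeze S<k S′<k k≤AB′ (BA′ t∈B t∈A′) (identity p q r a b)
        rot : ∀ i j l → i + (j + l) ≡ l + (j + i)
        rot = solve-∀
        b+≤p+ : b + (r + a) ≤ p + (r + a)
        b+≤p+ = ≤-trans (≤-reflexive (rot b r a)) (s≤s⁻¹ (<-≤-trans S′<k AA′))
        p+<a+ : p + (r + q) < a + (r + q)
        p+<a+ = <-≤-trans S<k (≤-trans k≤AB′ (≤-reflexive (rot q r a)))

      -- Then `B F′` lies in `S F` and has at most `q` vertices. But `AA′` gives `q ≤ a`, and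
      -- `a < ∣ A F ∣ ≤ ∣ B F′ ∣`.
      empty-impossible : (∀ {t} → t ∉ A F ∩ B F′) → ⊥
      empty-impossible AB′-empty = <-irrefl refl (begin-strict
        q         ≤⟨ +-cancelˡ-≤ r q a (+-cancelˡ-≤ p (r + q) (r + a) (s≤s⁻¹ (<-≤-trans S<k AA′))) ⟩
        a         <⟨ a<A ⟩
        ∣ A F ∣   ≤⟨ A≤B′ ⟩
        ∣ B F′ ∣  ≤⟨ B′≤q AB′-empty ⟩
        q         ∎)
        where open ≤-Reasoning

      conclude : Dec (k ≤ ∣ corner F (swap F′) ∣) → Σ[ F″ ∈ Cut k z x ] ∣ A F″ ∣ < ∣ A F ∣
      conclude (yes k≤T) = ⊥-elim (large-impossible k≤T)
      conclude (no  k≰T) = isCut⇒cut isCut ,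
        p⊂q⇒∣p∣<∣q∣ (p∩q⊆p (A F) (B F′) , x , x∈A , x∉AB′)
        where
        x∉T : x ∉ corner F (swap F′)
        x∉T = corner∌B′ F (swap F′) x∈A′
        AB′∌T : ∀ {s} → s ∈ A F ∩ B F′ → s ∉ corner F (swap F′)
        AB′∌T s∈ = let s∈A , s∈B′ = x∈p∩q⁻ (A F) _ s∈ in corner∌ F (swap F′) s∈A s∈B′
        z∈AB′ : z ∈ A F ∩ B F′
        -- Without `z`, neither cut edge leaves `A F ∩ B F′`, so its corner would separate any
        -- vertex of it from `x` with fewer than `k` vertices. Hence the set would be empty.
        z∈AB′ = decidable-stable (z ∈? A F ∩ B F′) λ z∉ → empty-impossible λ {t} t∈ →
          k≰T (separator t∈ (AB′∌T t∈) x∉AB′ x∉T (closed z∉))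
          where
          closed : z ∉ A F ∩ B F′ → ∀ {s t} → s ∈ A F ∩ B F′ → Adj G s t →
                   t ∈ A F ∩ B F′ ⊎ t ∈ corner F (swap F′)
          closed z∉ {t = t} s∈ st with t ∈? A F ∩ B F′ | t ∈? corner F (swap F′)
          ... | yes t∈ | _      = inj₁ t∈
          ... | no  _  | yes t∈ = inj₂ t∈
          ... | no  t∉ | no t∉T with AB′-exit s∈ t∉ t∉T st
          ...   | refl , _ = contradiction s∈ z∉
        isCut : IsCut k z x (A F ∩ B F′) (corner F (swap F′))
        isCut = ≰⇒> k≰T , z∈AB′ , x∉AB′ , x∉T , (λ _ → AB′∌T) , λ _ _ → AB′-exit

    -- Vertex sets in which every edge is a `k`-cut edge.

    module _ (U : Subset n) (k<degree : ∀ {x} → x ∈ U → k < degree G x)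
             (cut : ∀ {x y} → x ∈ U → y ∈ U → Adj G x y → Cut k x y) where

      -- The minimal side is reached by descent on `∣ A F ∣`: if `B F` or `B F′` is smaller, the
      -- swapped cut takes over, and otherwise uncrossing yields a smaller side. The edge of the new
      -- cut stays inside `X` each time.
      leafless⇒edgeless : ∀ {X} → X ⊆ U →
        (∀ {x y} → x ∈ X → y ∈ X → Adj G x y → ∃ λ z → z ∈ X × Adj G x z × z ≢ y) →
        ∀ {x y} → x ∈ X → y ∈ X → ¬ Adj G x y
      leafless⇒edgeless {X} X⊆U leafless x∈X y∈X xy =
        descend x∈X y∈X xy (cut (X⊆U x∈X) (X⊆U y∈X) xy) (<-wellFounded _)
        where
        descend : ∀ {x y} → x ∈ X → y ∈ X → Adj G x y → (F : Cut k x y) → Acc _<_ ∣ A F ∣ → ⊥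
        descend x∈X y∈X xy F (acc rs) with ∣ B F ∣ <? ∣ A F ∣ | leafless x∈X y∈X xy
        ... | yes B<A | _ = descend y∈X x∈X (adj-sym G xy) (swap F) (rs B<A)
        ... | no  B≮A | z , z∈X , xz , z≢y with cut (X⊆U x∈X) (X⊆U z∈X) xz
        ...   | F′ with ∣ B F′ ∣ <? ∣ A F ∣
        ...     | yes B′<A = descend z∈X x∈X (adj-sym G xz) (swap F′) (rs B′<A)
        ...     | no  B′≮A
          with uncross (k<degree (X⊆U x∈X)) xy xz z≢y F F′ (≮⇒≥ B≮A) (≮⇒≥ B′≮A)
        ...       | F″ , A″<A = descend z∈X x∈X (adj-sym G xz) F″ (rs A″<A)

      -- Quantifying over t expresses that v has at least two neighbours in X.
      ¬at-most-one-leaf : ∀ {X} → Acc _⊂_ X → X ⊆ U → ∀ {y y₁} → y ∈ X → y₁ ∈ X → Adj G y y₁ →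
        (∀ {v} → v ∈ X → v ≢ y → ∀ t → ∃ λ z → z ∈ X × Adj G v z × z ≢ t) → ⊥
      ¬at-most-one-leaf {X} (acc rs) X⊆U {y} {y₁} y∈X y₁∈X yy₁ branching
        with any? (λ z → z ∈? X ×-dec adj? G y z ×-dec ¬? (z ≟ y₁))
      ... | yes (y₂ , y₂∈X , yy₂ , y₂≢y₁) = leafless⇒edgeless X⊆U leafless y∈X y₁∈X yy₁
        where
        leafless : ∀ {x t} → x ∈ X → t ∈ X → Adj G x t → ∃ λ z → z ∈ X × Adj G x z × z ≢ t
        leafless {x} {t} x∈X _ _ with x ≟ y | t ≟ y₁
        ... | no x≢y   | _        = branching x∈X x≢y t
        ... | yes refl | yes refl = y₂ , y₂∈X , yy₂ , y₂≢y₁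
        ... | yes refl | no t≢y₁  = y₁ , y₁∈X , yy₁ , t≢y₁ ∘ sym
      -- Now `y₁` is the only neighbour of `y` in `X`. Deleting `y` therefore costs no vertex but
      -- `y₁` a neighbour, and `y₁` becomes the exceptional vertex; it keeps `y₂`.
      ... | no y-leaf with branching y₁∈X (λ y₁≡y → adj-irrefl G (sym y₁≡y) yy₁) y
      ...   | y₂ , y₂∈X , y₁y₂ , y₂≢y =
        ¬at-most-one-leaf (rs (∖-⊂ y∈X)) (X⊆U ∘ proj₁ ∘ ∈-∖⁻ {p = X})
          (∈-∖⁺ y₁∈X (λ y₁≡y → adj-irrefl G (sym y₁≡y) yy₁)) (∈-∖⁺ y₂∈X y₂≢y) y₁y₂ branching′
        where
        branching′ : ∀ {v} → v ∈ X ∖ y → v ≢ y₁ → ∀ t → ∃ λ z → z ∈ X ∖ y × Adj G v z × z ≢ t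
        branching′ v∈ v≢y₁ t with ∈-∖⁻ {p = X} v∈
        ... | v∈X , v≢y with branching v∈X v≢y t
        ...   | z , z∈X , vz , z≢t = z , ∈-∖⁺ z∈X z≢y , vz , z≢t
          where
          z≢y : z ≢ y
          z≢y refl = y-leaf (_ , v∈X , adj-sym G vz , v≢y₁)

      -- If `B F` lay in `U`, each of its vertices would have degree above `k`, hence at least two
      -- neighbours outside `S F`. These lie in `B F`, except that one neighbour of `y` may be `x`;
      -- so only `y` can be a leaf.
      cut-side⊈U : ∀ {x y} (F : Cut k x y) → ¬ (B F ⊆ U)
      cut-side⊈U {x} {y} F B⊆U = contra
        where
        ∈B : ∀ {v z} → v ∈ B F → Adj G v z → z ∉ S F → z ∈ B F ⊎ (v ≡ y × z ≡ x)
        ∈B {z = z} v∈B vz z∉S with cover F z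
        ... | inj₁ z∈A        = inj₂ (crosses (swap F) v∈B z∈A vz)
        ... | inj₂ (inj₁ z∈S) = contradiction z∈S z∉S
        ... | inj₂ (inj₂ z∈B) = inj₁ z∈B
        neighbour : ∀ {v} → v ∈ B F → ∀ t → ∃ λ z → Adj G v z × z ∉ S F × z ≢ t
        neighbour v∈B t with neighbour-outside (S F ∪ ⁅ t ⁆)
          (≤-<-trans (∣p∪⁅x⁆∣≤1+∣p∣ (S F) t) (≤-<-trans (small F) (k<degree (B⊆U v∈B))))
        ... | z , vz , z∉ = let z∉S , z∉t = ∉-∪⁻ z∉ in z , vz , z∉S , x∉⁅y⁆⇒x≢y z∉t
        branching : ∀ {v} → v ∈ B F → v ≢ y → ∀ t → ∃ λ z → z ∈ B F × Adj G v z × z ≢ t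
        branching v∈B v≢y t with neighbour v∈B t
        ... | z , vz , z∉S , z≢t with ∈B v∈B vz z∉S
        ...   | inj₁ z∈B       = z , z∈B , vz , z≢t
        ...   | inj₂ (v≡y , _) = contradiction v≡y v≢y
        contra : ⊥
        contra with neighbour (end∈B F) x
        ... | y₁ , yy₁ , y₁∉S , y₁≢x with ∈B (end∈B F) yy₁ y₁∉S
        ...   | inj₁ y₁∈B       = ¬at-most-one-leaf (⊂-wellFounded (B F)) B⊆U (end∈B F) y₁∈B yy₁ branching
        ...   | inj₂ (_ , y₁≡x) = contradiction y₁≡x y₁≢x

    -- The leaf outside `W` and its cut.

    ¬all-edges-cut : (W : Subset n) → W ⊂ ⊤ →
      (∀ {x} → x ∈ ∁ W → k < degree G x) → (∀ {x} → x ∈ ∁ W → ∣ W ∣ < degree G x) →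
      ¬ (∀ {x y} → x ∈ ∁ W → y ∈ ∁ W → Adj G x y → Cut k x y)
    ¬all-edges-cut W (_ , u , _ , u∉W) k<d w<d cut
      with any? (λ x → any? (λ y → x ∈? ∁ W ×-dec y ∈? ∁ W ×-dec adj? G x y ×-dec
             all? (λ z → z ∈? ∁ W →-dec adj? G x z →-dec z ≟ y)))
    -- Degree above `∣ W ∣` gives `u` a neighbour outside `W`, so the leafless set `∁ W` does
    -- contain an edge.
    ... | no no-leaf with neighbour-outside W (w<d (x∉p⇒x∈∁p u∉W))
    ...   | v , uv , v∉W =
      leafless⇒edgeless (∁ W) k<d cut (λ x∈ → x∈) leafless (x∉p⇒x∈∁p u∉W) (x∉p⇒x∈∁p v∉W) uv
      where
      leafless : ∀ {x y} → x ∈ ∁ W → y ∈ ∁ W → Adj G x y →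
                 ∃ λ z → z ∈ ∁ W × Adj G x z × z ≢ y
      leafless {x} {y} x∈U y∈U xy
        with any? (λ z → z ∈? ∁ W ×-dec adj? G x z ×-dec ¬? (z ≟ y))
      ... | yes found = found
      ... | no  none  = contradiction
        (x , y , x∈U , y∈U , xy , λ z z∈U xz →
          decidable-stable (z ≟ y) (λ z≢y → none (z , z∈U , xz , z≢y)))
        no-leaf
    ¬all-edges-cut W _ k<d w<d cut | yes (x , y , x∈U , y∈U , xy , leaf) =
      cut-side⊈U (∁ W) k<d cut F B⊆U
      where
      F = cut x∈U y∈U xy
      -- All neighbours of the leaf `x` lie in `W` or equal `y`. If `t` were missing, there would be
      -- at most `∣ W ∣` of them, fewer than the degree.
      W⊆N : ∀ {t} → t ∈ W → Adj G x t
      W⊆N {t} t∈W = decidable-stable (adj? G x t) λ ¬xt → refute ¬xt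
        (neighbour-outside ((W ∖ t) ∪ ⁅ y ⁆)
          (≤-<-trans (∣p∪⁅x⁆∣≤1+∣p∣ (W ∖ t) y) (≤-<-trans (p⊂q⇒∣p∣<∣q∣ (∖-⊂ t∈W)) (w<d x∈U))))
        where
        refute : ¬ Adj G x t → ¬ (∃ λ z → Adj G x z × z ∉ (W ∖ t) ∪ ⁅ y ⁆)
        refute ¬xt (z , xz , z∉) with ∉-∪⁻ z∉ | z ∈? W
        ... | _     , z∉y | no z∉W  = x∉⁅y⁆⇒x≢y z∉y (leaf z (x∉p⇒x∈∁p z∉W) xz)
        ... | z∉W∖t , _   | yes z∈W = z∉W∖t (∈-∖⁺ z∈W (λ { refl → ¬xt xz }))
      B⊆U : B F ⊆ ∁ W
      -- A vertex of `W` in `B F` is adjacent to `x`, so that edge crosses the cut and its end is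
      -- `y`, which is outside `W`.
      B⊆U t∈B = x∉p⇒x∈∁p λ t∈W →
        x∈∁p⇒x∉p y∈U (subst (_∈ W) (proj₂ (crosses F (end∈A F) t∈B (W⊆N t∈W))) t∈W)

    -- Deleting an edge that is not a `k`-cut edge.

    ¬cut⇒removable : (e : Edge G) → ¬ Cut k (end₁ e) (end₂ e) → Removable k G e
    ¬cut⇒removable e@(edge u v uv) ¬cut = proj₁ κ , connected
      where
      H = deleteEdge G e
      connected : (S : Subset n) → ∣ S ∣ < k → Connected (H [ ∁ S ])
      connected S S<k (x , x∈) (y , y∈) = joined (y ∈? R)
        where
        Reached : Fin n → Set
        Reached z = Σ[ z∈ ∈ z ∈ ∁ S ] Star (Adj (H [ ∁ S ])) (x , x∈) (z , z∈)
        Step : Fin n → Fin n → Set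
        Step p q = q ∈ ∁ S × Adj H p q
        reachable = closure Reached Step (λ p q → q ∈? ∁ S ×-dec adj? H p q)
          (λ { (_ , path) (q∈ , pq) → q∈ , path ◅◅ (pq ◅ ε) }) {x} (x∈ , ε)
        R = proj₁ reachable
        x∈R = proj₁ (proj₂ reachable)
        reached : ∀ {z} → z ∈ R → Reached z
        reached = proj₁ (proj₂ (proj₂ reachable))
        R-closed : ∀ {p q} → p ∈ R → Step p q → q ∈ R
        R-closed = proj₂ (proj₂ (proj₂ reachable))
        R∌S : ∀ {p} → p ∈ R → p ∉ S
        R∌S p∈R = x∈∁p⇒x∉p (proj₁ (reached p∈R))
        exit : ∀ {p q} → p ∈ R → q ∉ R → q ∉ S → Adj G p q → ¬ ¬ IsEnds e p q
        exit p∈R q∉R q∉S pq ¬ends = q∉R (R-closed p∈R (x∉p⇒x∈∁p q∉S , pq , ¬ends))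
        joined : Dec (y ∈ R) → Star (Adj (H [ ∁ S ])) (x , x∈) (y , y∈)
        joined (yes y∈R) with reached y∈R
        -- Vertices of an induced subgraph carry a membership proof, so the end of the path has to
        -- be identified with the given vertex.
        ... | y∈′ , path = subst (λ i → Star (Adj (H [ ∁ S ])) (x , x∈) (y , i)) ([]=-irrelevant y∈′ y∈) path
        -- Either no edge of `G` leaves `R` outside `S`, and `S` separates `x` from `y` in `G`, or
        -- such an edge is `e`, and `R` and `S` form a cut for it.
        joined (no y∉R) = ⊥-elim (<⇒≱ S<k
          (separator x∈R (R∌S x∈R) y∉R (x∈∁p⇒x∉p y∈) (λ {p} {q} → stay {p} {q})))
          where
          uncut : ∀ {p q} → p ∈ R → q ∉ R → q ∉ S → ¬ IsEnds e p q
          uncut {p} {q} p∈R q∉R q∉S ends = cut-at ends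
            where
            only-exit : ∀ p′ q′ → p′ ∈ R → q′ ∉ R → q′ ∉ S → Adj G p′ q′ → p′ ≡ p × q′ ≡ q
            -- A second edge leaving `R` would also be `e`, and traversed the same way, because `p`
            -- is in `R` and `q′` is not.
            only-exit p′ q′ p′∈R q′∉R q′∉S p′q′ = decidable-stable (p′ ≟ p ×-dec q′ ≟ q)
              λ differ → exit p′∈R q′∉R q′∉S p′q′ (same-orientation differ ends)
              where
              same-orientation : ¬ (p′ ≡ p × q′ ≡ q) → IsEnds e p q → ¬ IsEnds e p′ q′
              same-orientation differ (inj₁ (refl , refl)) (inj₁ eqs)        = differ eqs
              same-orientation differ (inj₁ (refl , refl)) (inj₂ (_ , refl)) = q′∉R p∈R
              same-orientation differ (inj₂ (refl , refl)) (inj₁ (_ , refl)) = q′∉R p∈R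
              same-orientation differ (inj₂ (refl , refl)) (inj₂ eqs)        = differ eqs
            R-cut : Cut k p q
            R-cut = isCut⇒cut (S<k , p∈R , q∉R , q∉S , (λ _ → R∌S) , only-exit)
            cut-at : ¬ IsEnds e p q
            cut-at (inj₁ (refl , refl)) = ¬cut R-cut
            cut-at (inj₂ (refl , refl)) = ¬cut (swap R-cut)
          stay : ∀ {p q} → p ∈ R → Adj G p q → q ∈ R ⊎ q ∈ S
          stay {p} {q} p∈R pq with q ∈? R | q ∈? S
          ... | yes q∈R | _       = inj₁ q∈R
          ... | no  _   | yes q∈S = inj₂ q∈S
          ... | no  q∉R | no q∉S  = ⊥-elim (exit p∈R q∉R q∉S pq (uncut p∈R q∉R q∉S))

corollary1p5 : (k : ℕ) .{{_ : NonZero k}} (n : ℕ) (G : Graph (Fin n)) → KConnected k G →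
    (W : Subset n) → W ⊂ ⊤ →
    (∀ x → x ∈ ∁ W → degree G x ≥ (k + 1) ⊔ (∣ W ∣ + 1)) →
    Σ[ e ∈ Edge (G [ ∁ W ]) ] Removable k G (includeEdge e)
corollary1p5 k n G κ W W⊂⊤ deg
  with any? (λ x → any? (λ y →
         x ∈? ∁ W ×-dec y ∈? ∁ W ×-dec adj? G x y ×-dec ¬? (cut? G k x y)))
... | yes (x , y , x∈U , y∈U , xy , ¬cut) =
  edge (x , x∈U) (y , y∈U) xy , ¬cut⇒removable G κ (edge x y xy) ¬cut
... | no all-cut = ⊥-elim (¬all-edges-cut G κ W W⊂⊤
  (λ x∈U → ≤-trans (≤-trans (≤-reflexive (+-comm 1 k)) (m≤m⊔n _ _)) (deg _ x∈U))
  (λ x∈U → ≤-trans (≤-trans (≤-reflexive (+-comm 1 ∣ W ∣)) (m≤n⊔m (k + 1) _)) (deg _ x∈U))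
  (λ {x} {y} x∈U y∈U xy →
    decidable-stable (cut? G k x y) (λ ¬cut → all-cut (x , y , x∈U , y∈U , xy , ¬cut))))
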